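{- Let $X\subset\mathbb{R}^n$ be a non-empty convex set and $\mathcal{A}\subset\mathbb{R}^n$ a non-empty finite set. Let $\nu^{(1)}$ and $\nu^{(2)}$ be $X$-circuits of $\mathcal{A}$ with the same signed support and such that $\mathcal{A}\nu^{(1)}=\mathcal{A}\nu^{(2)}$. Then $\nu^{(1)}$ and $\nu^{(2)}$ are proportional, and in case $\mathcal{A}\nu^{(1)}=\mathcal{A}\nu^{(2)}\neq\mathbf{0}$, the equality $\nu^{(1)}=\nu^{(2)}$ holds.
   Context: $\mathbb{R}^{\mathcal{A}}$ is the set of real vectors indexed by $\mathcal{A}$. For $\beta\in\mathcal{A}$, $N_\beta=\{\nu\in\mathbb{R}^{\mathcal{A}} : \nu_\alpha\ge 0 \text{ for all }\alpha\in\mathcal{A}\setminus\{\beta\},\ \sum_{\alpha\in\mathcal{A}}\nu_\alpha=0\}$. For $\nu\in\mathbb{R}^{\mathcal{A}}$ write $\mathcal{A}\nu=\sum_{\alpha\in\mathcal{A}}\alpha\,\nu_\alpha\in\mathbb{R}^n$. $\sigma_X(y)=\sup\{y^Tx : x\in X\}$ is the support function. A non-zero vector $\nu^*\in N_\beta$ (for some $\beta\in\mathcal{A}$) is an $X$-circuit (sublinear circuit of $\mathcal{A}$ with respect to $X$) if (i) $\sigma_X(-\mathcal{A}\nu^*)<\infty$, and (ii) whenever the map $\nu\mapsto\sigma_X(-\mathcal{A}\nu)$ is linear on a two-dimensional convex cone contained in $N_\beta$ (i.e. is finite there and coincides there with a linear function), $\nu^*$ is not in the relative interior of that cone. Two vectors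 have the same signed support if their sets of indices with positive entry coincide and their sets of indices with negative entry coincide. -}

module Defs where

open import Level using (0ℓ) renaming (suc to lsuc)
open import Algebra.Bundles using (CommutativeRing)
open import Algebra.Module.Bundles.Raw using (RawLeftModule)
open import Algebra.Module.Construct.TensorUnit using (rawLeftModule)
open import Algebra.Module.Morphism.Structures using (module LeftModuleMorphisms)
open import Axiom.ExcludedMiddle using (ExcludedMiddle)
open import Data.Fin.Base using (Fin)
open import Data.Nat.Base using (ℕ)
open import Data.Product.Base using (∃; _×_; _,_; proj₁; proj₂)
open import Data.Vec.Functional using (Vector; replicate; map; zipWith)
open import Function.Bundles using (_⇔_)
open import Relation.Binary.Core using (Rel)
open import Relation.Binary.Definitions using (_Respects_)
open import Relation.Binary.PropositionalEquality.Core using (_≢_)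
open import Relation.Binary.Structures using (IsTotalOrder)
open import Relation.Nullary.Construct.Add.Extrema using (_±; ⊥±; ⊤±; [_])
open import Relation.Nullary.Decidable.Core using (yes; no)
open import Relation.Unary using (Pred; _∈_; _∉_; _⊆_; Satisfiable)
import Algebra.Properties.Monoid.Sum
import Data.Vec.Functional.Relation.Binary.Equality.Setoid
import Relation.Binary.Construct.Add.Extrema.Equality
import Relation.Binary.Construct.Add.Extrema.Strict
import Relation.Binary.Construct.NonStrictToStrict

-- The library has no real numbers. They are axiomatised as a
-- Dedekind-complete totally ordered field, which in the presence of
-- excluded middle determines them up to unique isomorphism.

record CompleteOrderedField : Set (lsuc 0ℓ) where
  infix 4 _≤_

  field
    commutativeRing : CommutativeRing 0ℓ 0ℓ

  open CommutativeRing commutativeRing public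

  field
    _≤_          : Rel Carrier 0ℓ
    isTotalOrder : IsTotalOrder _≈_ _≤_
    1≉0          : 1# ≉ 0#
    inverse      : ∀ x → x ≉ 0# → ∃ λ y → x * y ≈ 1#
    +-monoˡ-≤    : ∀ z {x y} → x ≤ y → x + z ≤ y + z
    *-nonNeg     : ∀ {x y} → 0# ≤ x → 0# ≤ y → 0# ≤ x * y

  IsUpperBound : Pred Carrier 0ℓ → Pred Carrier 0ℓ
  IsUpperBound S b = ∀ {x} → x ∈ S → x ≤ b

  IsSupremum : Pred Carrier 0ℓ → Pred Carrier 0ℓ
  IsSupremum S s = s ∈ IsUpperBound S × (∀ {b} → b ∈ IsUpperBound S → s ≤ b)

  field
    complete : ∀ S → Satisfiable S → Satisfiable (IsUpperBound S) →
               ∃ (IsSupremum S)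

  open Relation.Binary.Construct.NonStrictToStrict _≈_ _≤_ public using (_<_)

module SublinearCircuits (em : ExcludedMiddle 0ℓ) (F : CompleteOrderedField) where

  open CompleteOrderedField F public renaming (Carrier to ℝ)
  open Algebra.Properties.Monoid.Sum +-monoid public using (sum)
  open Data.Vec.Functional.Relation.Binary.Equality.Setoid setoid public using (_≋_)
  open Relation.Binary.Construct.Add.Extrema.Equality _≈_ public using (_≈±_)
  open Relation.Binary.Construct.Add.Extrema.Strict _<_ public using (_<±_)

  infix 10 ℝ^_
  ℝ^_ : ℕ → Set
  ℝ^ n = Vector ℝ n

  vectorSpace : ℕ → RawLeftModule ℝ 0ℓ 0ℓ
  vectorSpace n = record
    { Carrierᴹ = ℝ^ n
    ; _≈ᴹ_     = _≋_
    ; _+ᴹ_     = zipWith _+_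
    ; _*ₗ_     = λ c → map (c *_)
    ; 0ᴹ       = replicate n 0#
    ; -ᴹ_      = map (-_)
    }

  module _ {n : ℕ} where
    open RawLeftModule (vectorSpace n) public
      using (_+ᴹ_; _*ₗ_; 0ᴹ; -ᴹ_; _≉ᴹ_)

  infixl 7 _·_
  _·_ : ∀ {n} → ℝ^ n → ℝ^ n → ℝ
  x · y = sum (zipWith _*_ x y)

  dist² : ∀ {n} → ℝ^ n → ℝ^ n → ℝ
  dist² x y = (x +ᴹ -ᴹ y) · (x +ᴹ -ᴹ y)

  combine : ∀ {n k} → Vector (ℝ^ n) k → ℝ^ k → ℝ^ n
  combine v c j = sum (λ i → v i j * c i)

  IsLinear : ∀ {n} → (ℝ^ n → ℝ) → Set
  IsLinear {n} = IsLeftModuleHomomorphism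
    where open LeftModuleMorphisms (vectorSpace n) (rawLeftModule {R = rawRing})

  Proportional : ∀ {n} → Rel (ℝ^ n) 0ℓ
  Proportional u v = ∃ λ c → c ≉ 0# × u ≋ c *ₗ v

  -- A predicate on vectors is a set of vectors only if it is invariant
  -- under the setoid equality _≋_, hence the field `respects` below.

  record IsConvex {n} (X : Pred (ℝ^ n) 0ℓ) : Set where
    field
      respects : X Respects _≋_
      convex   : ∀ {x y t} → x ∈ X → y ∈ X → 0# ≤ t → t ≤ 1# →
                 t *ₗ x +ᴹ (1# - t) *ₗ y ∈ X

  record IsConvexCone {n} (C : Pred (ℝ^ n) 0ℓ) : Set where
    field
      respects  : C Respects _≋_
      nonEmpty  : Satisfiable C
      +-closed  : ∀ {x y} → x ∈ C → y ∈ C → x +ᴹ y ∈ C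
      *ₗ-closed : ∀ {c x} → 0# ≤ c → x ∈ C → c *ₗ x ∈ C

  AffineHull : ∀ {n} → Pred (ℝ^ n) 0ℓ → Pred (ℝ^ n) 0ℓ
  AffineHull {n} C w = ∃ λ k → ∃ λ (v : Vector (ℝ^ n) k) → ∃ λ (c : ℝ^ k) →
    (∀ i → v i ∈ C) × sum c ≈ 1# × w ≋ combine v c

  LinearlyIndependent : ∀ {n k} → Vector (ℝ^ n) k → Set
  LinearlyIndependent {k = k} v =
    ∀ (c : ℝ^ k) → combine v c ≋ 0ᴹ → c ≋ 0ᴹ

  -- The dimension of a set is that of its affine hull: C has dimension d
  -- if its affine hull is p + span b for d independent vectors b.

  HasDimension : ∀ {n} → Pred (ℝ^ n) 0ℓ → ℕ → Set
  HasDimension {n} C d =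
    ∃ λ (p : ℝ^ n) → ∃ λ (b : Vector (ℝ^ n) d) → LinearlyIndependent b ×
    (∀ w → w ∈ AffineHull C ⇔ ∃ λ (c : ℝ^ d) → w ≋ p +ᴹ combine b c)

  RelativeInterior : ∀ {n} → Pred (ℝ^ n) 0ℓ → Pred (ℝ^ n) 0ℓ
  RelativeInterior C x = x ∈ C × ∃ λ ε → 0# < ε ×
    (∀ w → w ∈ AffineHull C → dist² w x < ε * ε → w ∈ C)

  -- Excluded middle makes the supremum total, with values in [-∞, ∞].

  sup : Pred ℝ 0ℓ → ℝ ±
  sup S with em {Satisfiable S}
  ... | no  _  = ⊥±
  ... | yes ne with em {Satisfiable (IsUpperBound S)}
  ...   | no  _  = ⊤±
  ...   | yes bd = [ proj₁ (complete S ne bd) ]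

  σ : ∀ {n} → Pred (ℝ^ n) 0ℓ → ℝ^ n → ℝ ±
  σ X y = sup (λ r → ∃ λ x → x ∈ X × r ≈ y · x)

  -- A finite set 𝒜 ⊂ ℝⁿ with m elements is given by an injective
  -- enumeration 𝒜 : Vector (ℝ^ n) m. Then ℝ^𝒜 is ℝ^ m, an element β of 𝒜
  -- is an index β : Fin m, and 𝒜ν is combine 𝒜 ν.

  N : ∀ {m} → Fin m → Pred (ℝ^ m) 0ℓ
  N β ν = (∀ α → α ≢ β → 0# ≤ ν α) × sum ν ≈ 0#

  module _ {n m} (X : Pred (ℝ^ n) 0ℓ) (𝒜 : Vector (ℝ^ n) m) where

    LinearOn : Pred (ℝ^ m) 0ℓ → Set
    LinearOn C = ∃ λ (L : ℝ^ m → ℝ) → IsLinear L ×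
      (∀ ν → ν ∈ C → σ X (-ᴹ combine 𝒜 ν) ≈± [ L ν ])

    record IsCircuitAt (β : Fin m) (ν* : ℝ^ m) : Set (lsuc 0ℓ) where
      field
        nonZero     : ν* ≉ᴹ 0ᴹ
        ν*∈N        : ν* ∈ N β
        finite      : σ X (-ᴹ combine 𝒜 ν*) <± ⊤±
        notInRelInt : ∀ (C : Pred (ℝ^ m) 0ℓ) → IsConvexCone C →
                      HasDimension C 2 → C ⊆ N β → LinearOn C →
                      ν* ∉ RelativeInterior C

    IsCircuit : Pred (ℝ^ m) (lsuc 0ℓ)
    IsCircuit ν* = ∃ λ β → IsCircuitAt β ν*

  SameSignedSupport : ∀ {m} → Rel (ℝ^ m) 0ℓ
  SameSignedSupport μ ν =
    ∀ α → (0# < μ α ⇔ 0# < ν α) × (μ α < 0# ⇔ ν α < 0#)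

{-# OPTIONS --safe #-}
-- Let δ = ν₂ − ν₁, so that 𝒜δ = 0. If ν₁ and ν₂ were not proportional,
-- some 2×2 minor of (ν₁, δ) containing the common negative index β would
-- not vanish, which gives a linear functional ℓ of two coordinates with
-- ℓ(ν₁) = 1 and ℓ(δ) = 0. On the two-dimensional cone of all
-- w = a ν₁ + b δ in N β with a ≥ 0, the vector −𝒜w is a multiple of −𝒜ν₁
-- by a = ℓ(w) ≥ 0, so the support function is ℓ(w) σ(−𝒜ν₁), which is
-- linear. Equality of the signed supports makes every inequality that
-- defines the cone either strict at ν₁ or trivial on span(ν₁, δ). Hence
-- ν₁ is in the relative interior, contradicting that it is a circuit.

module Submission where

open import Level using (0ℓ)
open import Axiom.ExcludedMiddle using (ExcludedMiddle)
open import Data.Nat.Base using (ℕ; NonZero)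
open import Data.Product.Base using (_×_)
open import Data.Vec.Functional using (Vector)
open import Function.Definitions using (Injective)
open import Relation.Binary.PropositionalEquality.Core using (_≡_)
open import Relation.Unary using (Pred; Satisfiable)
open import Defs

open import Data.Fin.Base using (Fin; zero; suc)
open import Data.Fin.Properties using (_≟_)
open import Data.Nat.Base using (zero; suc)
open import Data.Product.Base using (∃; _,_; proj₁; proj₂)
open import Data.Sum.Base using (_⊎_; inj₁; inj₂; [_,_]′)
open import Data.Vec.Functional using ([]; _∷_)
open import Function.Base using (_∘_)
open import Function.Bundles using (Equivalence; mk⇔)
open import Relation.Binary.Bundles using (TotalOrder)
open import Relation.Binary.PropositionalEquality.Core as ≡ using (_≢_; subst)
open import Relation.Nullary.Construct.Add.Extrema using ([_]; ⊤±)
open import Relation.Nullary.Decidable.Core using (yes; no; decidable-stable)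
open import Relation.Nullary.Negation.Core using (¬_; contradiction)
open import Relation.Unary using (_∈_; _⊆_; _∩_)
import Algebra.Properties.AbelianGroup
import Algebra.Properties.Group
import Algebra.Properties.Ring
import Algebra.Properties.CommutativeMonoid.Sum
import Algebra.Properties.Semiring.Sum
import Algebra.Solver.Ring.NaturalCoefficients.Default
import Relation.Binary.Construct.Add.Extrema.Equality as ≈±
import Relation.Binary.Construct.NonStrictToStrict
import Relation.Binary.Reasoning.PartialOrder
import Relation.Binary.Reasoning.Setoid

-- Arithmetic and quadratic estimates in an ordered field.

module OrderedField (F : CompleteOrderedField) where

  open CompleteOrderedField F hiding (zero) renaming (Carrier to ℝ)
  open Algebra.Solver.Ring.NaturalCoefficients.Default commutativeSemiring public
    using (solve; _:+_; _:*_; _:=_; con)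
  open Algebra.Properties.AbelianGroup +-abelianGroup public using (⁻¹-anti-homo‿-; ⁻¹-∙-comm)
  open Algebra.Properties.Group +-group public
    using (⁻¹-involutive; x∙y⁻¹≈ε⇒x≈y; x≈y⇒x∙y⁻¹≈ε; //-rightDividesˡ)
  open Algebra.Properties.Ring ring public
    using (-1*x≈-x; -‿distribˡ-*; -‿distribʳ-*; x[y-z]≈xy-xz; [y-z]x≈yx-zx)

  totalOrder : TotalOrder 0ℓ 0ℓ 0ℓ
  totalOrder = record { isTotalOrder = isTotalOrder }

  open TotalOrder totalOrder public using (total; antisym; poset)
    renaming (refl to ≤-refl; trans to ≤-trans; reflexive to ≤-reflexive)

  module ≤-Reasoning = Relation.Binary.Reasoning.PartialOrder poset

  <⇒≱ : ∀ {x y} → x < y → ¬ (y ≤ x)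
  <⇒≱ = Relation.Binary.Construct.NonStrictToStrict.<⇒≱ _≈_ _≤_ antisym

  <-≤-trans : ∀ {a b c} → a < b → b ≤ c → a < c
  <-≤-trans = Relation.Binary.Construct.NonStrictToStrict.<-≤-trans _≈_ _≤_ sym ≤-trans antisym
    (λ y≈z x≤y → ≤-trans x≤y (≤-reflexive y≈z))

  +-mono-≤ : ∀ {x y u v} → x ≤ y → u ≤ v → x + u ≤ y + v
  +-mono-≤ {x} {y} {u} {v} x≤y u≤v = begin
    x + u  ≤⟨ +-monoˡ-≤ u x≤y ⟩
    y + u  ≈⟨ +-comm y u ⟩
    u + y  ≤⟨ +-monoˡ-≤ y u≤v ⟩
    v + y  ≈⟨ +-comm v y ⟩
    y + v  ∎
    where open ≤-Reasoning

  +-nonNeg : ∀ {x y} → 0# ≤ x → 0# ≤ y → 0# ≤ x + y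
  +-nonNeg 0≤x 0≤y = ≤-trans (≤-reflexive (sym (+-identityˡ 0#))) (+-mono-≤ 0≤x 0≤y)

  x≤x+y : ∀ {x y} → 0# ≤ y → x ≤ x + y
  x≤x+y {x} 0≤y = ≤-trans (≤-reflexive (sym (+-identityʳ x))) (+-mono-≤ ≤-refl 0≤y)

  x≤y+x : ∀ {x y} → 0# ≤ y → x ≤ y + x
  x≤y+x 0≤y = ≤-trans (x≤x+y 0≤y) (≤-reflexive (+-comm _ _))

  x≤y⇒0≤y-x : ∀ {x y} → x ≤ y → 0# ≤ y - x
  x≤y⇒0≤y-x {x} {y} x≤y = begin
    0#     ≈⟨ -‿inverseʳ x ⟨
    x - x  ≤⟨ +-monoˡ-≤ (- x) x≤y ⟩
    y - x  ∎
    where open ≤-Reasoning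

  0≤y-x⇒x≤y : ∀ {x y} → 0# ≤ y - x → x ≤ y
  0≤y-x⇒x≤y {x} {y} 0≤y-x = begin
    x            ≤⟨ x≤y+x 0≤y-x ⟩
    (y - x) + x  ≈⟨ //-rightDividesˡ x y ⟩
    y            ∎
    where open ≤-Reasoning

  x≤0⇒0≤-x : ∀ {x} → x ≤ 0# → 0# ≤ - x
  x≤0⇒0≤-x x≤0 = ≤-trans (x≤y⇒0≤y-x x≤0) (≤-reflexive (+-identityˡ _))

  *-monoˡ-≤ : ∀ {z x y} → 0# ≤ z → x ≤ y → z * x ≤ z * y
  *-monoˡ-≤ {z} {x} {y} 0≤z x≤y = 0≤y-x⇒x≤y (begin
    0#             ≤⟨ *-nonNeg 0≤z (x≤y⇒0≤y-x x≤y) ⟩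
    z * (y - x)    ≈⟨ x[y-z]≈xy-xz z y x ⟩
    z * y - z * x  ∎)
    where open ≤-Reasoning

  *-mono-≤ : ∀ {x y u v} → 0# ≤ u → 0# ≤ y → x ≤ y → u ≤ v → x * u ≤ y * v
  *-mono-≤ {x} {y} {u} {v} 0≤u 0≤y x≤y u≤v = begin
    x * u  ≈⟨ *-comm x u ⟩
    u * x  ≤⟨ *-monoˡ-≤ 0≤u x≤y ⟩
    u * y  ≈⟨ *-comm u y ⟩
    y * u  ≤⟨ *-monoˡ-≤ 0≤y u≤v ⟩
    y * v  ∎
    where open ≤-Reasoning

  square-mono-≤ : ∀ {x y} → 0# ≤ x → x ≤ y → x * x ≤ y * y
  square-mono-≤ 0≤x x≤y = *-mono-≤ 0≤x (≤-trans 0≤x x≤y) x≤y x≤y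

  -x*-x≈x*x : ∀ x → - x * - x ≈ x * x
  -x*-x≈x*x x = begin
    - x * - x      ≈⟨ -‿distribˡ-* x (- x) ⟨
    - (x * - x)    ≈⟨ -‿cong (-‿distribʳ-* x x) ⟨
    - - (x * x)    ≈⟨ ⁻¹-involutive (x * x) ⟩
    x * x          ∎
    where open Relation.Binary.Reasoning.Setoid setoid

  square-nonNeg : ∀ x → 0# ≤ x * x
  square-nonNeg x with total 0# x
  ... | inj₁ 0≤x = *-nonNeg 0≤x 0≤x
  ... | inj₂ x≤0 = ≤-trans (*-nonNeg 0≤-x 0≤-x) (≤-reflexive (-x*-x≈x*x x))
    where 0≤-x = x≤0⇒0≤-x x≤0

  0≤1 : 0# ≤ 1#
  0≤1 = ≤-trans (square-nonNeg 1#) (≤-reflexive (*-identityˡ 1#))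

  0<1 : 0# < 1#
  0<1 = 0≤1 , 1≉0 ∘ sym

  nonNeg-inverse : ∀ {x y} → 0# ≤ x → x * y ≈ 1# → 0# ≤ y
  nonNeg-inverse {x} {y} 0≤x xy≈1 with total 0# y
  ... | inj₁ 0≤y = 0≤y
  ... | inj₂ y≤0 = contradiction (antisym 1≤0 0≤1) 1≉0
    where
    open ≤-Reasoning
    1≤0 : 1# ≤ 0#
    1≤0 = begin
      1#      ≈⟨ xy≈1 ⟨
      x * y   ≤⟨ *-monoˡ-≤ 0≤x y≤0 ⟩
      x * 0#  ≈⟨ zeroʳ x ⟩
      0#      ∎

  integral : ∀ {x y} → x ≉ 0# → x * y ≈ 0# → y ≈ 0#
  integral {x} {y} x≉0 xy≈0 with inverse x x≉0
  ... | x⁻¹ , xx⁻¹≈1 = begin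
    y              ≈⟨ *-identityˡ y ⟨
    1# * y         ≈⟨ *-congʳ xx⁻¹≈1 ⟨
    x * x⁻¹ * y    ≈⟨ solve 3 (λ a b c → a :* b :* c := b :* (a :* c)) refl x x⁻¹ y ⟩
    x⁻¹ * (x * y)  ≈⟨ *-congˡ xy≈0 ⟩
    x⁻¹ * 0#       ≈⟨ zeroʳ x⁻¹ ⟩
    0#             ∎
    where open Relation.Binary.Reasoning.Setoid setoid

  -- Squaring is monotone here because `c` is non-negative, and afterwards only squares of `p` and
  -- `s` remain. Their signs therefore never matter and no absolute values or square roots are
  -- needed.
  square-≤ : ∀ {c p s d} → 0# ≤ c → c ≤ p * s + p * s → s * s ≤ d →
             c * c ≤ (p + p) * (p + p) * d
  square-≤ {c} {p} {s} {d} 0≤c c≤2ps s²≤d = begin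
    c * c                              ≤⟨ square-mono-≤ 0≤c c≤2ps ⟩
    (p * s + p * s) * (p * s + p * s)  ≈⟨ solve 2 (λ p s →
                                            (p :* s :+ p :* s) :* (p :* s :+ p :* s) :=
                                            (p :+ p) :* (p :+ p) :* (s :* s)) refl p s ⟩
    (p + p) * (p + p) * (s * s)        ≤⟨ *-monoˡ-≤ (square-nonNeg (p + p)) s²≤d ⟩
    (p + p) * (p + p) * d              ∎
    where open ≤-Reasoning

  module _ (p q : ℝ) where

    -- The last two summands dominate the factors that `square-≤` produces for `p` and for `q`. The
    -- summand one keeps the constant invertible, with inverse at most one.
    bound : ℝ
    bound = 1# + ((p + p) * (p + p) + (q + q) * (q + q))

    1≤bound : 1# ≤ bound
    1≤bound = x≤x+y (+-nonNeg (square-nonNeg (p + p)) (square-nonNeg (q + q)))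

    -- A coarse substitute for the Cauchy-Schwarz inequality: the larger of the two products is at
    -- least half of their sum, so `c` is at most twice that product and `square-≤` applies.
    square-≤-bound : ∀ {c s t d} → 0# ≤ c → c ≤ p * s + q * t →
                     s * s ≤ d → t * t ≤ d → c * c ≤ bound * d
    square-≤-bound {c} {s} {t} {d} 0≤c c≤ps+qt s²≤d t²≤d =
      [ (λ ps≤qt → ≤-trans (square-≤ 0≤c (≤-trans c≤ps+qt (+-mono-≤ ps≤qt ≤-refl)) t²≤d)
                     (*-monoʳ-≤-d (≤-trans (x≤y+x (square-nonNeg (p + p))) (x≤y+x 0≤1))))
      , (λ qt≤ps → ≤-trans (square-≤ 0≤c (≤-trans c≤ps+qt (+-mono-≤ ≤-refl qt≤ps)) s²≤d)
                     (*-monoʳ-≤-d (≤-trans (x≤x+y (square-nonNeg (q + q))) (x≤y+x 0≤1))))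
      ]′ (total (p * s) (q * t))
      where
      *-monoʳ-≤-d : ∀ {x y} → x ≤ y → x * d ≤ y * d
      *-monoʳ-≤-d {x} {y} x≤y = begin
        x * d  ≈⟨ *-comm x d ⟩
        d * x  ≤⟨ *-monoˡ-≤ (≤-trans (square-nonNeg s) s²≤d) x≤y ⟩
        d * y  ≈⟨ *-comm d y ⟩
        y * d  ∎
        where open ≤-Reasoning

module Circuits (em : ExcludedMiddle 0ℓ) (F : CompleteOrderedField) where

  open SublinearCircuits em F hiding (zero)
  open OrderedField F
  open Algebra.Properties.CommutativeMonoid.Sum +-commutativeMonoid
    using (sum-cong-≋; ∑-distrib-+)
  open Algebra.Properties.Semiring.Sum semiring using (*-distribˡ-sum)

  -- Finite sums and linear combinations.

  sum-linear : ∀ {k} (a b : ℝ) (x y : ℝ^ k) →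
               sum (λ i → a * x i + b * y i) ≈ a * sum x + b * sum y
  sum-linear a b x y = trans (∑-distrib-+ (λ i → a * x i) (λ i → b * y i))
    (+-cong (sym (*-distribˡ-sum a x)) (sym (*-distribˡ-sum b y)))

  sum-nonNeg : ∀ {k} (x : ℝ^ k) → (∀ i → 0# ≤ x i) → 0# ≤ sum x
  sum-nonNeg {zero}  x 0≤x = ≤-refl
  sum-nonNeg {suc k} x 0≤x = +-nonNeg (0≤x zero) (sum-nonNeg (x ∘ suc) (0≤x ∘ suc))

  term≤sum : ∀ {k} (x : ℝ^ k) → (∀ i → 0# ≤ x i) → ∀ i → x i ≤ sum x
  term≤sum x 0≤x zero    = x≤x+y (sum-nonNeg (x ∘ suc) (0≤x ∘ suc))
  term≤sum x 0≤x (suc i) = ≤-trans (term≤sum (x ∘ suc) (0≤x ∘ suc) i) (x≤y+x (0≤x zero))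

  combine-linear : ∀ {n k} (v : Vector (ℝ^ n) k) a b (x y : ℝ^ k) {w : ℝ^ k} →
                   w ≋ a *ₗ x +ᴹ b *ₗ y →
                   combine v w ≋ a *ₗ combine v x +ᴹ b *ₗ combine v y
  combine-linear v a b x y {w} w≋ j = begin
    sum (λ i → v i j * w i)
      ≈⟨ sum-cong-≋ (λ i → trans (*-congˡ (w≋ i))
           (solve 5 (λ f a x b y → f :* (a :* x :+ b :* y) := a :* (f :* x) :+ b :* (f :* y))
              refl (v i j) a (x i) b (y i))) ⟩
    sum (λ i → a * (v i j * x i) + b * (v i j * y i))
      ≈⟨ sum-linear a b (λ i → v i j * x i) (λ i → v i j * y i) ⟩
    a * combine v x j + b * combine v y j ∎
    where open Relation.Binary.Reasoning.Setoid setoid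

  -- Suprema and positive homogeneity of the support function.

  sup-finite : ∀ {S} → Satisfiable S → sup S <± ⊤± → ∃ (IsSupremum S)
  sup-finite {S} ne fin with em {Satisfiable S}
  -- An empty `S` would have supremum minus infinity, which also lies below `⊤±`; non-emptiness
  -- excludes it.
  ... | no  ¬ne = contradiction ne ¬ne
  ... | yes ne′ with em {Satisfiable (IsUpperBound S)}
  ...   | yes bd = complete S ne′ bd
  sup-finite ne () | yes ne′ | no _

  sup-unique : ∀ {S s} → Satisfiable S → IsSupremum S s → sup S ≈± [ s ]
  sup-unique {S} ne (ub , least) with em {Satisfiable S}
  ... | no  ¬ne = contradiction ne ¬ne
  ... | yes ne′ with em {Satisfiable (IsUpperBound S)}
  ...   | no  ¬bd = contradiction (_ , λ {x} → ub {x}) ¬bd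
  ...   | yes bd  with complete S ne′ bd
  ...     | t , ub′ , least′ =
    ≈±.[ antisym (least′ ub) (least ub′) ]

  -- The set inside the definition of `σ`, so that `σ X y` unfolds to `sup (Values X y)`.
  Values : ∀ {n} → Pred (ℝ^ n) 0ℓ → ℝ^ n → Pred ℝ 0ℓ
  Values X y r = ∃ λ x → x ∈ X × r ≈ y · x

  module _ {n} {X : Pred (ℝ^ n) 0ℓ} (ne : Satisfiable X) where

    values-satisfiable : ∀ y → Satisfiable (Values X y)
    values-satisfiable y = y · proj₁ ne , proj₁ ne , proj₂ ne , refl

    σ-homogeneous : ∀ {y y′ a s} → IsSupremum (Values X y) s → 0# ≤ a → y′ ≋ a *ₗ y →
                    σ X y′ ≈± [ a * s ]
    σ-homogeneous {y} {y′} {a} {s} (ub , least) 0≤a y′≋ay =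
      sup-unique (values-satisfiable y′) (ub′ , least′)
      where
      open ≤-Reasoning

      ·-homogeneous : ∀ x → y′ · x ≈ a * (y · x)
      ·-homogeneous x = trans
        (sum-cong-≋ λ i → trans (*-congʳ (y′≋ay i)) (*-assoc a (y i) (x i)))
        (sym (*-distribˡ-sum a (λ i → y i * x i)))

      ub′ : a * s ∈ IsUpperBound (Values X y′)
      ub′ {r} (x , x∈X , r≈y′x) = begin
        r            ≈⟨ r≈y′x ⟩
        y′ · x       ≈⟨ ·-homogeneous x ⟩
        a * (y · x)  ≤⟨ *-monoˡ-≤ 0≤a (ub (x , x∈X , refl)) ⟩
        a * s        ∎

      least′ : ∀ {b} → b ∈ IsUpperBound (Values X y′) → a * s ≤ b
      least′ {b} b-ub with em {a ≈ 0#}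
      -- For `a` zero one cannot divide; instead any point of the non-empty `X` shows that zero is
      -- attained, hence lies below `b`.
      ... | yes a≈0 = begin
        a * s            ≈⟨ *-congʳ a≈0 ⟩
        0# * s           ≈⟨ zeroˡ s ⟩
        0#               ≈⟨ zeroˡ _ ⟨
        0# * (y · x₀)    ≈⟨ *-congʳ a≈0 ⟨
        a * (y · x₀)     ≈⟨ ·-homogeneous x₀ ⟨
        y′ · x₀          ≤⟨ b-ub (x₀ , proj₂ ne , refl) ⟩
        b                ∎
        where x₀ = proj₁ ne
      ... | no a≉0 with inverse a a≉0
      ...   | a⁻¹ , aa⁻¹≈1 = begin
        a * s          ≤⟨ *-monoˡ-≤ 0≤a (least a⁻¹b-ub) ⟩
        a * (a⁻¹ * b)  ≈⟨ *-assoc a a⁻¹ b ⟨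
        a * a⁻¹ * b    ≈⟨ *-congʳ aa⁻¹≈1 ⟩
        1# * b         ≈⟨ *-identityˡ b ⟩
        b              ∎
        where
        a⁻¹b-ub : a⁻¹ * b ∈ IsUpperBound (Values X y)
        a⁻¹b-ub {r} (x , x∈X , r≈yx) = begin
          r                    ≈⟨ r≈yx ⟩
          y · x                ≈⟨ *-identityˡ _ ⟨
          1# * (y · x)         ≈⟨ *-congʳ (trans (*-comm a⁻¹ a) aa⁻¹≈1) ⟨
          a⁻¹ * a * (y · x)    ≈⟨ *-assoc a⁻¹ a _ ⟩
          a⁻¹ * (a * (y · x))  ≤⟨ *-monoˡ-≤ (nonNeg-inverse 0≤a aa⁻¹≈1)
                                   (≤-trans (≤-reflexive (sym (·-homogeneous x))) (b-ub (x , x∈X , refl))) ⟩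
          a⁻¹ * b              ∎

  -- Properties that hold on a ball around a point.

  Near : ∀ {m} → ℝ^ m → Pred (ℝ^ m) 0ℓ → Set
  Near x P = ∃ λ ε → 0# < ε × (∀ w → dist² w x < ε * ε → w ∈ P)

  module _ {m} {x : ℝ^ m} where

    near-always : ∀ {P : Pred (ℝ^ m) 0ℓ} → (∀ w → w ∈ P) → Near x P
    near-always p = 1# , 0<1 , λ w _ → p w

    near-∩ : ∀ {P Q : Pred (ℝ^ m) 0ℓ} → Near x P → Near x Q → Near x (P ∩ Q)
    near-∩ (ε , 0<ε , p) (η , 0<η , q) with total ε η
    ... | inj₁ ε≤η = ε , 0<ε , λ w d → p w d , q w (<-≤-trans d (square-mono-≤ (proj₁ 0<ε) ε≤η))
    ... | inj₂ η≤ε = η , 0<η , λ w d → p w (<-≤-trans d (square-mono-≤ (proj₁ 0<η) η≤ε)) , q w d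

    near-∀ : ∀ {k} {P : Fin k → Pred (ℝ^ m) 0ℓ} → (∀ i → Near x (P i)) → Near x (λ w → ∀ i → w ∈ P i)
    near-∀ {zero}  near = near-always λ _ ()
    near-∀ {suc k} near with near-∩ (near zero) (near-∀ (near ∘ suc))
    ... | ε , 0<ε , p = ε , 0<ε , λ w d → λ where
      zero    → proj₁ (p w d)
      (suc i) → proj₂ (p w d) i

    -- With `c` the positive value at `x` and `K` the constant `bound p q`, the radius `c / K`
    -- works. If the functional were at most zero at `w`, its drop from `x` to `w` would be at least
    -- `c`, so `square-≤-bound` would give that the square of `c` is at most `K` times the squared
    -- distance. Dividing by the square of `K`, which is at least one, would put `w` outside the
    -- ball.
    near-nonNeg : ∀ p q i j → 0# < p * x i + q * x j → Near x (λ w → 0# ≤ p * w i + q * w j)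
    near-nonNeg p q i j (0≤c , 0≉c) = c * K⁻¹ , (0≤ε , 0≉ε) , nonNeg
      where
      open ≤-Reasoning
      c = p * x i + q * x j
      K = bound p q
      0≤K = ≤-trans 0≤1 (1≤bound p q)
      K≉0 : K ≉ 0#
      K≉0 K≈0 = 1≉0 (antisym (≤-trans (1≤bound p q) (≤-reflexive K≈0)) 0≤1)
      K⁻¹ = proj₁ (inverse K K≉0)
      KK⁻¹≈1 = proj₂ (inverse K K≉0)
      0≤K⁻¹ = nonNeg-inverse 0≤K KK⁻¹≈1
      0≤ε = *-nonNeg 0≤c 0≤K⁻¹

      0≉ε : 0# ≉ c * K⁻¹
      0≉ε 0≈ε = 0≉c (sym (begin-equality
        c              ≈⟨ *-identityʳ c ⟨
        c * 1#         ≈⟨ *-congˡ KK⁻¹≈1 ⟨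
        c * (K * K⁻¹)  ≈⟨ solve 3 (λ c K k → c :* (K :* k) := K :* (c :* k)) refl c K K⁻¹ ⟩
        K * (c * K⁻¹)  ≈⟨ *-congˡ 0≈ε ⟨
        K * 0#         ≈⟨ zeroʳ K ⟩
        0#             ∎))

      K⁻¹≤1 : K⁻¹ ≤ 1#
      K⁻¹≤1 = begin
        K⁻¹       ≈⟨ *-identityʳ K⁻¹ ⟨
        K⁻¹ * 1#  ≤⟨ *-monoˡ-≤ 0≤K⁻¹ (1≤bound p q) ⟩
        K⁻¹ * K   ≈⟨ *-comm K⁻¹ K ⟩
        K * K⁻¹   ≈⟨ KK⁻¹≈1 ⟩
        1#        ∎

      coordinate≤dist² : ∀ w k → (x k - w k) * (x k - w k) ≤ dist² w x
      coordinate≤dist² w k = begin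
        (x k - w k) * (x k - w k)      ≈⟨ *-cong (⁻¹-anti-homo‿- (w k) (x k)) (⁻¹-anti-homo‿- (w k) (x k)) ⟨
        - (w k - x k) * - (w k - x k)  ≈⟨ -x*-x≈x*x (w k - x k) ⟩
        (w k - x k) * (w k - x k)      ≤⟨ term≤sum _ (λ l → square-nonNeg (w l - x l)) k ⟩
        dist² w x                      ∎

      nonNeg : ∀ w → dist² w x < (c * K⁻¹) * (c * K⁻¹) → 0# ≤ p * w i + q * w j
      nonNeg w d<ε² with total 0# (p * w i + q * w j)
      ... | inj₁ 0≤f = 0≤f
      ... | inj₂ f≤0 = contradiction ε²≤d (<⇒≱ d<ε²)
        where
        d = dist² w x

        c≤ : c ≤ p * (x i - w i) + q * (x j - w j)
        c≤ = begin
          -- Subtracting the value at `w`, assumed to be at most zero, can only increase `c`.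
          c                                        ≤⟨ x≤x+y (x≤0⇒0≤-x f≤0) ⟩
          c - (p * w i + q * w j)                  ≈⟨ +-congˡ (trans (sym (⁻¹-∙-comm _ _)) (+-cong (-‿distribʳ-* p (w i)) (-‿distribʳ-* q (w j)))) ⟩
          c + (p * - w i + q * - w j)              ≈⟨ solve 6 (λ p a b q e f →
                                                        p :* a :+ q :* e :+ (p :* b :+ q :* f) :=
                                                        p :* (a :+ b) :+ q :* (e :+ f))
                                                        refl p (x i) (- w i) q (x j) (- w j) ⟩
          p * (x i - w i) + q * (x j - w j)        ∎

        ε²≤d : (c * K⁻¹) * (c * K⁻¹) ≤ d
        ε²≤d = begin
          (c * K⁻¹) * (c * K⁻¹)  ≈⟨ solve 2 (λ c k → (c :* k) :* (c :* k) := (k :* k) :* (c :* c)) refl c K⁻¹ ⟩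
          (K⁻¹ * K⁻¹) * (c * c)  ≤⟨ *-monoˡ-≤ (square-nonNeg K⁻¹) (square-≤-bound p q 0≤c c≤ (coordinate≤dist² w i) (coordinate≤dist² w j)) ⟩
          (K⁻¹ * K⁻¹) * (K * d)  ≈⟨ solve 3 (λ k K d → (k :* k) :* (K :* d) := (K :* k) :* (d :* k)) refl K⁻¹ K d ⟩
          (K * K⁻¹) * (d * K⁻¹)  ≈⟨ *-congʳ KK⁻¹≈1 ⟩
          1# * (d * K⁻¹)         ≈⟨ *-identityˡ _ ⟩
          d * K⁻¹                ≤⟨ *-monoˡ-≤ (≤-trans (square-nonNeg _) (coordinate≤dist² w i)) K⁻¹≤1 ⟩
          d * 1#                 ≈⟨ *-identityʳ d ⟩
          d                      ∎

  -- Linear functionals of two coordinates.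

  functional : ∀ {m} → ℝ → ℝ → Fin m → Fin m → ℝ^ m → ℝ
  functional p q i j w = p * w i + q * w j

  functional-isLinear : ∀ {m} p q (i j : Fin m) → IsLinear (functional p q i j)
  functional-isLinear p q i j = record
    { +ᴹ-isGroupHomomorphism = record
      { isMonoidHomomorphism = record
        { isMagmaHomomorphism = record
          { isRelHomomorphism = record { cong = λ w≋ → +-cong (*-congˡ (w≋ i)) (*-congˡ (w≋ j)) }
          ; homo = λ x y → solve 6 (λ p a b q c d →
              p :* (a :+ b) :+ q :* (c :+ d) := p :* a :+ q :* c :+ (p :* b :+ q :* d))
              refl p (x i) (y i) q (x j) (y j)
          }
        ; ε-homo = trans (+-cong (zeroʳ p) (zeroʳ q)) (+-identityˡ 0#)
        }
      ; ⁻¹-homo = λ x → trans (+-cong (sym (-‿distribʳ-* p (x i))) (sym (-‿distribʳ-* q (x j))))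
                              (⁻¹-∙-comm (p * x i) (q * x j))
      }
    ; *ₗ-homo = λ c x → solve 5 (λ c p a q b → p :* (c :* a) :+ q :* (c :* b) := c :* (p :* a :+ q :* b))
                          refl c p (x i) q (x j)
    }

  -- The two-dimensional cone in the plane of two vectors.

  module Plane {m} (ν δ : ℝ^ m) where

    Span : Pred (ℝ^ m) 0ℓ
    Span w = ∃ λ a → ∃ λ b → w ≋ a *ₗ ν +ᴹ b *ₗ δ

    Span-combine : ∀ {k} (v : Vector (ℝ^ m) k) (c : ℝ^ k) → (∀ i → v i ∈ Span) → combine v c ∈ Span
    Span-combine v c v∈ = sum (λ i → a i * c i) , sum (λ i → b i * c i) , λ k → begin
      sum (λ i → v i k * c i)
        ≈⟨ sum-cong-≋ (λ i → trans (*-congʳ (proj₂ (proj₂ (v∈ i)) k))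
             (solve 5 (λ a x b y c → (a :* x :+ b :* y) :* c := x :* (a :* c) :+ y :* (b :* c))
                refl (a i) (ν k) (b i) (δ k) (c i))) ⟩
      sum (λ i → ν k * (a i * c i) + δ k * (b i * c i))
        ≈⟨ sum-linear (ν k) (δ k) (λ i → a i * c i) (λ i → b i * c i) ⟩
      ν k * sum (λ i → a i * c i) + δ k * sum (λ i → b i * c i)
        ≈⟨ +-cong (*-comm _ _) (*-comm _ _) ⟩
      sum (λ i → a i * c i) * ν k + sum (λ i → b i * c i) * δ k ∎
      where
      open Relation.Binary.Reasoning.Setoid setoid
      a = λ i → proj₁ (v∈ i)
      b = λ i → proj₁ (proj₂ (v∈ i))

    basis : Vector (ℝ^ m) 2
    basis = ν ∷ δ ∷ []

    combine-basis : ∀ c → combine basis c ≋ c zero *ₗ ν +ᴹ c (suc zero) *ₗ δ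
    combine-basis c k = +-cong (*-comm _ _) (trans (+-identityʳ _) (*-comm _ _))

    -- Membership in the span only asserts that some coefficients exist. A functional that is one on
    -- `ν` and zero on `δ` recovers the coefficient of `ν` from the vector itself.
    functional-Span : ∀ {p q i j w a b} → functional p q i j ν ≈ 1# → functional p q i j δ ≈ 0# →
                      w ≋ a *ₗ ν +ᴹ b *ₗ δ → functional p q i j w ≈ a
    functional-Span {p} {q} {i} {j} {w} {a} {b} ℓν≈1 ℓδ≈0 w≋ = begin
      p * w i + q * w j
        ≈⟨ +-cong (*-congˡ (w≋ i)) (*-congˡ (w≋ j)) ⟩
      p * (a * ν i + b * δ i) + q * (a * ν j + b * δ j)
        ≈⟨ solve 8 (λ p q a b x y z u →
             p :* (a :* x :+ b :* y) :+ q :* (a :* z :+ b :* u) :=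
             a :* (p :* x :+ q :* z) :+ b :* (p :* y :+ q :* u))
             refl p q a b (ν i) (δ i) (ν j) (δ j) ⟩
      a * (p * ν i + q * ν j) + b * (p * δ i + q * δ j)
        ≈⟨ +-cong (*-congˡ ℓν≈1) (*-congˡ ℓδ≈0) ⟩
      a * 1# + b * 0#
        ≈⟨ +-cong (*-identityʳ a) (zeroʳ b) ⟩
      a + 0#
        ≈⟨ +-identityʳ a ⟩
      a ∎
      where open Relation.Binary.Reasoning.Setoid setoid

    -- The bound on `a` is there because `σ` is homogeneous only for non-negative factors; without
    -- it linearity could fail.
    Cone : Fin m → Pred (ℝ^ m) 0ℓ
    Cone β w = ∃ λ a → ∃ λ b → 0# ≤ a × w ≋ a *ₗ ν +ᴹ b *ₗ δ × (∀ α → α ≢ β → 0# ≤ w α)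

    Cone-isConvexCone : ∀ β → IsConvexCone (Cone β)
    Cone-isConvexCone β = record
      { respects  = λ { x≋y (a , b , 0≤a , x≋ , 0≤x) →
          a , b , 0≤a , (λ k → trans (sym (x≋y k)) (x≋ k)) ,
          λ α α≢β → ≤-trans (0≤x α α≢β) (≤-reflexive (x≋y α)) }
      ; nonEmpty  = (λ _ → 0#) , 0# , 0# , ≤-refl ,
          (λ k → sym (trans (+-cong (zeroˡ _) (zeroˡ _)) (+-identityˡ 0#))) , λ _ _ → ≤-refl
      ; +-closed  = λ { (a , b , 0≤a , x≋ , 0≤x) (c , d , 0≤c , y≋ , 0≤y) →
          a + c , b + d , +-nonNeg 0≤a 0≤c ,
          (λ k → trans (+-cong (x≋ k) (y≋ k))
             (solve 6 (λ a b c d x y → a :* x :+ b :* y :+ (c :* x :+ d :* y) :=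
                                       (a :+ c) :* x :+ (b :+ d) :* y)
                refl a b c d (ν k) (δ k))) ,
          λ α α≢β → +-nonNeg (0≤x α α≢β) (0≤y α α≢β) }
      ; *ₗ-closed = λ { {c} 0≤c (a , b , 0≤a , x≋ , 0≤x) →
          c * a , c * b , *-nonNeg 0≤c 0≤a ,
          (λ k → trans (*-congˡ (x≋ k))
             (solve 5 (λ c a b x y → c :* (a :* x :+ b :* y) := c :* a :* x :+ c :* b :* y)
                refl c a b (ν k) (δ k))) ,
          λ α α≢β → *-nonNeg 0≤c (0≤x α α≢β) }
      }

    AffineHull⇒Span : ∀ {β w} → w ∈ AffineHull (Cone β) → w ∈ Span
    AffineHull⇒Span (_ , v , c , v∈ , _ , w≋)
      with Span-combine v c (λ i → let (a , b , _ , v≋ , _) = v∈ i in a , b , v≋)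
    ... | a , b , vc≋ = a , b , λ k → trans (w≋ k) (vc≋ k)

    Cone⊆N : ∀ {β} → sum ν ≈ 0# → sum δ ≈ 0# → Cone β ⊆ N β
    Cone⊆N ∑ν≈0 ∑δ≈0 {w} (a , b , _ , w≋ , 0≤w) = 0≤w , (begin
      sum w                          ≈⟨ sum-cong-≋ w≋ ⟩
      sum (λ k → a * ν k + b * δ k)  ≈⟨ sum-linear a b ν δ ⟩
      a * sum ν + b * sum δ          ≈⟨ +-cong (*-congˡ ∑ν≈0) (*-congˡ ∑δ≈0) ⟩
      a * 0# + b * 0#                ≈⟨ +-cong (zeroʳ a) (zeroʳ b) ⟩
      0# + 0#                        ≈⟨ +-identityˡ 0# ⟩
      0#                             ∎)
      where open Relation.Binary.Reasoning.Setoid setoid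

    module _ {β : Fin m} (0≤ν : ∀ α → α ≢ β → 0# ≤ ν α) where

      ν∈Cone : ν ∈ Cone β
      ν∈Cone = 1# , 0# , 0≤1 ,
        (λ k → sym (trans (+-cong (*-identityˡ _) (zeroˡ _)) (+-identityʳ _))) , 0≤ν

      -- The points `ν`, `ν + δ` and the origin of the cone affinely span the plane: the first two
      -- produce the vector with weights `a - b` and `b`, and the origin takes the weight `1 - a`
      -- that brings the total to one.
      Span⇒AffineHull : (∀ α → α ≢ β → 0# ≤ ν α + δ α) → ∀ {w} → w ∈ Span → w ∈ AffineHull (Cone β)
      Span⇒AffineHull 0≤ν+δ {w} (a , b , w≋) = 3 , v , c , v∈ , sum-c , w≋vc
        where
        open Relation.Binary.Reasoning.Setoid setoid
        v : Vector (ℝ^ m) 3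
        v = ν ∷ (ν +ᴹ δ) ∷ 0ᴹ ∷ []
        c : ℝ^ 3
        c = (a - b) ∷ b ∷ (1# - a) ∷ []
        v∈ : ∀ i → v i ∈ Cone β
        v∈ zero             = ν∈Cone
        v∈ (suc zero)       = 1# , 1# , 0≤1 ,
          (λ k → sym (+-cong (*-identityˡ _) (*-identityˡ _))) , 0≤ν+δ
        v∈ (suc (suc zero)) = IsConvexCone.respects (Cone-isConvexCone β) (λ k → zeroˡ _)
          (IsConvexCone.*ₗ-closed (Cone-isConvexCone β) {0#} ≤-refl ν∈Cone)
        sum-c : sum c ≈ 1#
        sum-c = begin
          (a - b) + (b + ((1# - a) + 0#))
            ≈⟨ solve 5 (λ a a′ b b′ o → (a :+ b′) :+ (b :+ ((o :+ a′) :+ con 0)) := o :+ ((a :+ a′) :+ (b :+ b′)))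
                 refl a (- a) b (- b) 1# ⟩
          1# + ((a - a) + (b - b))  ≈⟨ +-congˡ (+-cong (-‿inverseʳ a) (-‿inverseʳ b)) ⟩
          1# + (0# + 0#)            ≈⟨ +-congˡ (+-identityˡ 0#) ⟩
          1# + 0#                   ≈⟨ +-identityʳ 1# ⟩
          1#                        ∎
        w≋vc : w ≋ combine v c
        w≋vc k = begin
          -- The solver knows only semirings and treats `- b` as an independent atom, so the
          -- cancelling pair `b - b` is inserted by hand beforehand.
          w k                                  ≈⟨ w≋ k ⟩
          a * ν k + b * δ k                    ≈⟨ +-congʳ (*-congʳ (+-identityʳ a)) ⟨
          (a + 0#) * ν k + b * δ k             ≈⟨ +-congʳ (*-congʳ (+-congˡ (-‿inverseʳ b))) ⟨
          (a + (b - b)) * ν k + b * δ k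
            ≈⟨ solve 6 (λ a b b′ x y z →
                 (a :+ (b :+ b′)) :* x :+ b :* y :=
                 x :* (a :+ b′) :+ ((x :+ y) :* b :+ (con 0 :* z :+ con 0)))
                 refl a b (- b) (ν k) (δ k) (1# - a) ⟩
          ν k * (a - b) + ((ν k + δ k) * b + (0# * (1# - a) + 0#)) ∎

      module _ {p q i j} (ℓν≈1 : functional p q i j ν ≈ 1#) (ℓδ≈0 : functional p q i j δ ≈ 0#) where

        -- Applying the functional to a vanishing combination annihilates `δ` and isolates the
        -- coefficient of `ν`; what remains is a multiple of the non-zero `δ`.
        basis-independent : δ ≉ᴹ 0ᴹ → LinearlyIndependent basis
        basis-independent δ≉0 c cb≋0 = λ { zero → c₀≈0 ; (suc zero) → c₁≈0 }
          where
          open Relation.Binary.Reasoning.Setoid setoid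
          c₁ = c (suc zero)
          c₀≈0 : c zero ≈ 0#
          c₀≈0 = begin
            c zero           ≈⟨ functional-Span ℓν≈1 ℓδ≈0 (λ k → trans (sym (cb≋0 k)) (combine-basis c k)) ⟨
            p * 0# + q * 0#  ≈⟨ +-cong (zeroʳ p) (zeroʳ q) ⟩
            0# + 0#          ≈⟨ +-identityˡ 0# ⟩
            0#               ∎
          c₁≈0 : c₁ ≈ 0#
          c₁≈0 = decidable-stable em λ c₁≉0 → δ≉0 λ k → integral c₁≉0 (begin
            c₁ * δ k                 ≈⟨ +-identityˡ _ ⟨
            0# + c₁ * δ k            ≈⟨ +-congʳ (trans (*-congʳ c₀≈0) (zeroˡ _)) ⟨
            c zero * ν k + c₁ * δ k  ≈⟨ combine-basis c k ⟨
            combine basis c k        ≈⟨ cb≋0 k ⟩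
            0#                       ∎)

        Cone-dimension : δ ≉ᴹ 0ᴹ → (∀ α → α ≢ β → 0# ≤ ν α + δ α) → HasDimension (Cone β) 2
        -- The cone contains the origin, so its affine hull is a linear subspace and the base point
        -- can be zero.
        Cone-dimension δ≉0 0≤ν+δ = 0ᴹ , basis , basis-independent δ≉0 , λ w → mk⇔
          (λ w∈ → let (a , b , w≋) = AffineHull⇒Span w∈ in a ∷ b ∷ [] , λ k →
             trans (w≋ k) (sym (trans (+-identityˡ _) (combine-basis (a ∷ b ∷ []) k))))
          (λ (c , w≋) → Span⇒AffineHull 0≤ν+δ (c zero , c (suc zero) , λ k →
             trans (w≋ k) (trans (+-identityˡ _) (combine-basis c k))))

        -- Only finitely many inequalities cut the cone out of the plane. Each holds on some ball
        -- around `ν` intersected with the plane, and the smallest of the radii serves for all of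
        -- them.
        ν∈RelativeInterior : (∀ α → α ≢ β → 0# < ν α ⊎ ν α ≈ 0# × δ α ≈ 0#) →
                             ν ∈ RelativeInterior (Cone β)
        ν∈RelativeInterior ν>0⊎≈0 = ν∈Cone , ε , 0<ε , λ w w∈ d →
          let (a , b , w≋) = AffineHull⇒Span w∈
              (0≤ℓw , 0≤w) = inside w d
          -- The functional equals `a` at `w`, so its non-negativity near `ν` is the condition on
          -- `a` in the cone.
          in a , b , ≤-trans 0≤ℓw (≤-reflexive (functional-Span ℓν≈1 ℓδ≈0 w≋)) , w≋ ,
             λ α α≢β → 0≤w α α≢β (a , b , w≋)
          where
          0<ℓν : 0# < functional p q i j ν
          0<ℓν = ≤-trans 0≤1 (≤-reflexive (sym ℓν≈1)) , λ 0≈ℓν → 1≉0 (trans (sym ℓν≈1) (sym 0≈ℓν))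

          coordinate : ∀ w α → functional 1# 0# α α w ≈ w α
          coordinate w α = trans (+-cong (*-identityˡ _) (zeroˡ _)) (+-identityʳ _)

          -- The balls of `Near` are full-dimensional. Hence the span condition is part of the
          -- predicate: a coordinate that vanishes at both `ν` and `δ` has a controlled sign only
          -- inside the plane.
          near-coordinate : ∀ α → Near ν (λ w → α ≢ β → w ∈ Span → 0# ≤ w α)
          near-coordinate α with α ≟ β
          ... | yes α≡β = near-always λ _ α≢β → contradiction α≡β α≢β
          ... | no α≢β with ν>0⊎≈0 α α≢β
          ...   | inj₁ (0≤να , 0≉να) =
            let (η , 0<η , near) = near-nonNeg 1# 0# α α
                  (≤-trans 0≤να (≤-reflexive (sym (coordinate ν α))) ,
                   λ 0≈ → 0≉να (trans 0≈ (coordinate ν α)))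
            in η , 0<η , λ w d _ _ → ≤-trans (near w d) (≤-reflexive (coordinate w α))
          ...   | inj₂ (να≈0 , δα≈0) = near-always λ { w _ (a , b , w≋) → ≤-reflexive (sym (begin
            w α                ≈⟨ w≋ α ⟩
            a * ν α + b * δ α  ≈⟨ +-cong (*-congˡ να≈0) (*-congˡ δα≈0) ⟩
            a * 0# + b * 0#    ≈⟨ +-cong (zeroʳ a) (zeroʳ b) ⟩
            0# + 0#            ≈⟨ +-identityˡ 0# ⟩
            0#                 ∎)) }
            where open Relation.Binary.Reasoning.Setoid setoid

          near-inside = near-∩ (near-nonNeg p q i j 0<ℓν) (near-∀ near-coordinate)
          ε = proj₁ near-inside
          0<ε = proj₁ (proj₂ near-inside)
          inside = proj₂ (proj₂ near-inside)

        Cone-linearOn : ∀ {n} {X : Pred (ℝ^ n) 0ℓ} {𝒜 : Vector (ℝ^ n) m} → Satisfiable X →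
                        combine 𝒜 δ ≋ 0ᴹ → σ X (-ᴹ combine 𝒜 ν) <± ⊤± → LinearOn X 𝒜 (Cone β)
        Cone-linearOn {X = X} {𝒜} ne 𝒜δ≋0 fin
          with sup-finite (values-satisfiable ne (-ᴹ combine 𝒜 ν)) fin
        -- With `s` the support value at `ν`, the linear function is `s` times the given functional,
        -- the factor being absorbed into the two coefficients.
        ... | s , s-sup = functional (p * s) (q * s) i j , functional-isLinear (p * s) (q * s) i j ,
          λ { w (a , b , 0≤a , w≋ , _) → ≈±.≈±-trans _≈_ trans
            (σ-homogeneous ne s-sup 0≤a (λ k → begin
              - combine 𝒜 w k
                ≈⟨ -‿cong (combine-linear 𝒜 a b ν δ w≋ k) ⟩
              - (a * combine 𝒜 ν k + b * combine 𝒜 δ k)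
                ≈⟨ -‿cong (+-congˡ (trans (*-congˡ (𝒜δ≋0 k)) (zeroʳ b))) ⟩
              - (a * combine 𝒜 ν k + 0#)
                ≈⟨ -‿cong (+-identityʳ _) ⟩
              - (a * combine 𝒜 ν k)
                ≈⟨ -‿distribʳ-* a _ ⟩
              a * - combine 𝒜 ν k ∎))
            ≈±.[ (begin
              a * s                        ≈⟨ *-congʳ (functional-Span ℓν≈1 ℓδ≈0 w≋) ⟨
              (p * w i + q * w j) * s      ≈⟨ solve 5 (λ p x q y s → (p :* x :+ q :* y) :* s :=
                                                p :* s :* x :+ q :* s :* y) refl p (w i) q (w j) s ⟩
              p * s * w i + q * s * w j    ∎) ] }
          where open Relation.Binary.Reasoning.Setoid setoid

  -- Negative entries and criteria for proportionality.

  negative-at : ∀ {m} {β : Fin m} {ν} → ν ∈ N β → ν ≉ᴹ 0ᴹ → ν β < 0#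
  negative-at {β = β} {ν} (0≤ν , ∑ν≈0) ν≉0 =
    [ (λ 0≤νβ → contradiction 0≤νβ 0≰νβ) , (λ νβ≤0 → νβ≤0) ]′ (total 0# (ν β)) ,
    λ νβ≈0 → 0≰νβ (≤-reflexive (sym νβ≈0))
    where
    0≰νβ : ¬ (0# ≤ ν β)
    -- All entries would be non-negative with sum zero, so each is squeezed between zero and the
    -- sum.
    0≰νβ 0≤νβ = ν≉0 λ k → antisym (≤-trans (term≤sum ν 0≤ν′ k) (≤-reflexive ∑ν≈0)) (0≤ν′ k)
      where
      0≤ν′ : ∀ α → 0# ≤ ν α
      0≤ν′ α with α ≟ β
      ... | yes α≡β = subst (λ α → 0# ≤ ν α) (≡.sym α≡β) 0≤νβ
      ... | no  α≢β = 0≤ν α α≢β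

  -- Two circuits come with their own indices; this identifies them once the negative supports
  -- agree.
  negative-index-unique : ∀ {m} {β γ : Fin m} {ν} → ν ∈ N γ → ν β < 0# → γ ≡ β
  negative-index-unique {β = β} {γ} (0≤ν , _) νβ<0 with γ ≟ β
  ... | yes γ≡β = γ≡β
  ... | no  γ≢β = contradiction (0≤ν β (γ≢β ∘ ≡.sym)) (<⇒≱ νβ<0)

  cross-proportional : ∀ {m} {μ ν : ℝ^ m} β → μ β ≉ 0# → ν β ≉ 0# →
                       (∀ j → μ β * ν j ≈ ν β * μ j) → Proportional μ ν
  cross-proportional {μ = μ} {ν} β μβ≉0 νβ≉0 cross with inverse (ν β) νβ≉0
  -- The factor is the quotient of the entries at `β`; it is non-zero because `μ β` is.
  ... | e , νβe≈1 = μ β * e , (λ μβe≈0 → 1≉0 (begin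
      1#           ≈⟨ νβe≈1 ⟨
      ν β * e      ≈⟨ *-congˡ (integral μβ≉0 μβe≈0) ⟩
      ν β * 0#     ≈⟨ zeroʳ (ν β) ⟩
      0#           ∎)) , λ j → begin
    μ j              ≈⟨ *-identityˡ (μ j) ⟨
    1# * μ j         ≈⟨ *-congʳ νβe≈1 ⟨
    ν β * e * μ j    ≈⟨ solve 3 (λ x e y → x :* e :* y := e :* (x :* y)) refl (ν β) e (μ j) ⟩
    e * (ν β * μ j)  ≈⟨ *-congˡ (cross j) ⟨
    e * (μ β * ν j)  ≈⟨ solve 3 (λ x e y → e :* (x :* y) := x :* e :* y) refl (μ β) e (ν j) ⟩
    μ β * e * ν j    ∎
    where open Relation.Binary.Reasoning.Setoid setoid

  eigenvalue-unique : ∀ {m} {c} {v : ℝ^ m} → v ≉ᴹ 0ᴹ → v ≋ c *ₗ v → c ≈ 1#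
  eigenvalue-unique {c = c} {v} v≉0 v≋cv = decidable-stable em λ c≉1 →
    v≉0 λ k → integral (c≉1 ∘ x∙y⁻¹≈ε⇒x≈y c 1#) (begin
      (c - 1#) * v k        ≈⟨ [y-z]x≈yx-zx (v k) c 1# ⟩
      c * v k - 1# * v k    ≈⟨ x≈y⇒x∙y⁻¹≈ε (trans (sym (v≋cv k)) (sym (*-identityˡ _))) ⟩
      0#                    ∎)
    where open Relation.Binary.Reasoning.Setoid setoid

  -- Two circuits with equal signed supports and equal images.

  module _ {n m} {X : Pred (ℝ^ n) 0ℓ} (ne : Satisfiable X) {𝒜 : Vector (ℝ^ n) m} {ν₁ ν₂ : ℝ^ m}
           (same : SameSignedSupport ν₁ ν₂) (𝒜ν₁≋𝒜ν₂ : combine 𝒜 ν₁ ≋ combine 𝒜 ν₂) where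

    private
      δ : ℝ^ m
      δ = ν₂ +ᴹ -ᴹ ν₁

      δ≋ : δ ≋ 1# *ₗ ν₂ +ᴹ (- 1#) *ₗ ν₁
      δ≋ k = sym (+-cong (*-identityˡ _) (-1*x≈-x _))

      1x-1y≈0 : ∀ {x y} → x ≈ y → 1# * x + - 1# * y ≈ 0#
      1x-1y≈0 {x} {y} x≈y = trans (+-cong (*-identityˡ x) (-1*x≈-x y)) (x≈y⇒x∙y⁻¹≈ε x≈y)

    -- Where `ν₁` vanishes away from `β`, a non-zero entry of `ν₂` would be positive, and equality
    -- of the supports would make the entry of `ν₁` positive too. So `ν₂`, and with it `δ`, vanishes
    -- there.
    signs : ∀ {β} → ν₁ ∈ N β → ν₂ ∈ N β → ∀ α → α ≢ β → 0# < ν₁ α ⊎ ν₁ α ≈ 0# × δ α ≈ 0#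
    signs (0≤ν₁ , _) (0≤ν₂ , _) α α≢β with em {0# ≈ ν₁ α}
    ... | no  0≉ν₁α = inj₁ (0≤ν₁ α α≢β , 0≉ν₁α)
    ... | yes 0≈ν₁α = inj₂ (sym 0≈ν₁α , x≈y⇒x∙y⁻¹≈ε (trans (sym 0≈ν₂α) 0≈ν₁α))
      where
      0≈ν₂α : 0# ≈ ν₂ α
      0≈ν₂α = decidable-stable em λ 0≉ν₂α →
        proj₂ (Equivalence.from (proj₁ (same α)) (0≤ν₂ α α≢β , 0≉ν₂α)) 0≈ν₁α

    circuits-proportional : IsCircuit X 𝒜 ν₁ → IsCircuit X 𝒜 ν₂ → Proportional ν₁ ν₂
    circuits-proportional (β , circuit₁) (γ , circuit₂) = decidable-stable em not-disproportional
      where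
      open Relation.Binary.Reasoning.Setoid setoid
      open IsCircuitAt circuit₁
      ν₁β<0 : ν₁ β < 0#
      ν₁β<0 = negative-at {β = β} {ν₁} ν*∈N nonZero
      ν₂β<0 : ν₂ β < 0#
      ν₂β<0 = Equivalence.to (proj₂ (same β)) ν₁β<0
      ν₂∈N : ν₂ ∈ N β
      ν₂∈N = subst (λ β → ν₂ ∈ N β)
        (negative-index-unique {ν = ν₂} (IsCircuitAt.ν*∈N circuit₂) ν₂β<0) (IsCircuitAt.ν*∈N circuit₂)

      -- The determinant of the rows `β` and `j` of the matrix with columns `ν₁` and `δ`, written as
      -- a sum to suit the semiring solver.
      minor : Fin m → ℝ
      minor j = ν₁ β * δ j + - δ β * ν₁ j

      minor≈0⇒cross : ∀ j → minor j ≈ 0# → ν₁ β * ν₂ j ≈ ν₂ β * ν₁ j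
      minor≈0⇒cross j minor≈0 = begin
        ν₁ β * ν₂ j                      ≈⟨ *-congˡ (//-rightDividesˡ (ν₁ j) (ν₂ j)) ⟨
        ν₁ β * (δ j + ν₁ j)              ≈⟨ distribˡ (ν₁ β) (δ j) (ν₁ j) ⟩
        ν₁ β * δ j + ν₁ β * ν₁ j         ≈⟨ +-congʳ (x∙y⁻¹≈ε⇒x≈y _ _
                                              (trans (+-congˡ (-‿distribˡ-* (δ β) (ν₁ j))) minor≈0)) ⟩
        δ β * ν₁ j + ν₁ β * ν₁ j         ≈⟨ distribʳ (ν₁ j) (δ β) (ν₁ β) ⟨
        (δ β + ν₁ β) * ν₁ j              ≈⟨ *-congʳ (//-rightDividesˡ (ν₁ β) (ν₂ β)) ⟩
        ν₂ β * ν₁ j                      ∎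

      0≤ν₁+δ : ∀ α → α ≢ β → 0# ≤ ν₁ α + δ α
      0≤ν₁+δ α α≢β = ≤-trans (proj₁ ν₂∈N α α≢β)
        (≤-reflexive (sym (trans (+-comm _ _) (//-rightDividesˡ (ν₁ α) (ν₂ α)))))

      ∑δ≈0 : sum δ ≈ 0#
      ∑δ≈0 = trans (sum-cong-≋ δ≋) (trans (sum-linear 1# (- 1#) ν₂ ν₁)
        (1x-1y≈0 (trans (proj₂ ν₂∈N) (sym (proj₂ ν*∈N)))))

      𝒜δ≋0 : combine 𝒜 δ ≋ 0ᴹ
      𝒜δ≋0 k = trans (combine-linear 𝒜 1# (- 1#) ν₂ ν₁ δ≋ k) (1x-1y≈0 (sym (𝒜ν₁≋𝒜ν₂ k)))

      not-disproportional : ¬ ¬ Proportional ν₁ ν₂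
      not-disproportional ¬prop with em {∃ λ j → minor j ≉ 0#}
      -- If every minor with row `β` vanishes, all cross products agree and `ν₁` is proportional to
      -- `ν₂`.
      ... | no ¬minor = ¬prop (cross-proportional {μ = ν₁} {ν₂} β (proj₂ ν₁β<0) (proj₂ ν₂β<0)
        λ j → minor≈0⇒cross j (decidable-stable em λ minor≉0 → ¬minor (j , minor≉0)))
      ... | yes (j , minor≉0) with inverse (minor j) minor≉0
      ...   | e , minor*e≈1 = notInRelInt (Cone β) (Cone-isConvexCone β)
        (Cone-dimension 0≤ν₁ ℓν≈1 ℓδ≈0 δ≉0 0≤ν₁+δ)
        (λ {w} → Cone⊆N (proj₂ ν*∈N) ∑δ≈0 {w})
        (Cone-linearOn 0≤ν₁ ℓν≈1 ℓδ≈0 ne 𝒜δ≋0 finite)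
        (ν∈RelativeInterior 0≤ν₁ ℓν≈1 ℓδ≈0 (signs ν*∈N ν₂∈N))
        where
        open Plane ν₁ δ
        0≤ν₁ = proj₁ ν*∈N

        -- Cramer's rule: with `e` the inverse of the minor, the functional sends `w` to the
        -- determinant of `w` and `δ` in rows `β` and `j`, divided by that of `ν₁` and `δ`. At `δ`
        -- the two columns coincide and it vanishes.
        ℓν≈1 : functional (δ j * e) (- δ β * e) β j ν₁ ≈ 1#
        ℓν≈1 = trans
          (solve 5 (λ d e x b y → d :* e :* x :+ b :* e :* y := (x :* d :+ b :* y) :* e)
             refl (δ j) e (ν₁ β) (- δ β) (ν₁ j))
          minor*e≈1

        ℓδ≈0 : functional (δ j * e) (- δ β * e) β j δ ≈ 0#
        ℓδ≈0 = begin
          δ j * e * δ β + - δ β * e * δ j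
            ≈⟨ solve 4 (λ d e x x′ → d :* e :* x :+ x′ :* e :* d := (x :+ x′) :* (e :* d))
                 refl (δ j) e (δ β) (- δ β) ⟩
          (δ β - δ β) * (e * δ j)  ≈⟨ *-congʳ (-‿inverseʳ (δ β)) ⟩
          0# * (e * δ j)           ≈⟨ zeroˡ _ ⟩
          0#                       ∎

        δ≉0 : δ ≉ᴹ 0ᴹ
        δ≉0 δ≋0 = ¬prop (1# , 1≉0 , λ k →
          trans (sym (x∙y⁻¹≈ε⇒x≈y _ _ (δ≋0 k))) (sym (*-identityˡ (ν₂ k))))

    -- Applying `𝒜` to the proportionality turns the common non-zero image into `c` times itself,
    -- which forces `c` to be one.
    proportional⇒equal : Proportional ν₁ ν₂ → combine 𝒜 ν₁ ≉ᴹ 0ᴹ → ν₁ ≋ ν₂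
    proportional⇒equal (c , _ , ν₁≋cν₂) 𝒜ν₁≉0 k = begin
      ν₁ k       ≈⟨ ν₁≋cν₂ k ⟩
      c * ν₂ k   ≈⟨ *-congʳ (eigenvalue-unique {v = combine 𝒜 ν₁} 𝒜ν₁≉0 𝒜ν₁≋c𝒜ν₁) ⟩
      1# * ν₂ k  ≈⟨ *-identityˡ (ν₂ k) ⟩
      ν₂ k       ∎
      where
      open Relation.Binary.Reasoning.Setoid setoid
      𝒜ν₁≋c𝒜ν₁ : combine 𝒜 ν₁ ≋ c *ₗ combine 𝒜 ν₁
      𝒜ν₁≋c𝒜ν₁ j = begin
        -- `combine-linear` expects two summands, so a second one with coefficient zero is added.
        combine 𝒜 ν₁ j                         ≈⟨ combine-linear 𝒜 c 0# ν₂ ν₂ (λ k → trans (ν₁≋cν₂ k) (sym x+0y≈x)) j ⟩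
        c * combine 𝒜 ν₂ j + 0# * combine 𝒜 ν₂ j  ≈⟨ x+0y≈x ⟩
        c * combine 𝒜 ν₂ j                     ≈⟨ *-congˡ (𝒜ν₁≋𝒜ν₂ j) ⟨
        c * combine 𝒜 ν₁ j                     ∎
        where
        x+0y≈x : ∀ {x y} → x + 0# * y ≈ x
        x+0y≈x = trans (+-congˡ (zeroˡ _)) (+-identityʳ _)

lemma3p3 : (em : ExcludedMiddle 0ℓ) (F : CompleteOrderedField) →
    let open SublinearCircuits em F in
    (n : ℕ) (X : Pred (ℝ^ n) 0ℓ) → Satisfiable X → IsConvex X →
    (m : ℕ) → NonZero m →
    (𝒜 : Vector (ℝ^ n) m) → Injective _≡_ _≋_ 𝒜 →
    (ν₁ ν₂ : ℝ^ m) → IsCircuit X 𝒜 ν₁ → IsCircuit X 𝒜 ν₂ →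
    SameSignedSupport ν₁ ν₂ → combine 𝒜 ν₁ ≋ combine 𝒜 ν₂ →
    Proportional ν₁ ν₂ × (combine 𝒜 ν₁ ≉ᴹ 0ᴹ → ν₁ ≋ ν₂)
lemma3p3 em F n X ne _ m _ 𝒜 _ ν₁ ν₂ circuit₁ circuit₂ same 𝒜ν₁≋𝒜ν₂ =
  proportional , proportional⇒equal ne same 𝒜ν₁≋𝒜ν₂ proportional
  where
  open Circuits em F
  proportional = circuits-proportional ne same 𝒜ν₁≋𝒜ν₂ circuit₁ circuit₂
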